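{- Let $G=(V,E,w)$ be a finite undirected graph with non-negative integer edge weights and let $T=\{t_1,\dots,t_k\}\subseteq V$ be a non-empty set of terminals. Let $v\in V\setminus T$, and let $(V_v,V\setminus V_v)$, with $v\in V_v$, be the largest minimum isolating cut of $v$ and the set of terminals $T$, of weight $\lambda(G,v,T)$. Then there exists at least one minimum multiterminal cut of $G$ with respect to $T$ in which every $x\in V_v$ is in the same block as $v$.
   Context: For a vertex $s$ and a non-empty vertex set $T$ with $s\notin T$, a minimum $s$-$T$-cut (also called minimum isolating cut for $s$ and $T$) is a bipartition $(S,V\setminus S)$ of $V$ with $s\in S$ and $T\subseteq V\setminus S$ minimizing the total weight of the edges between $S$ and $V\setminus S$; this minimum weight is denoted $\lambda(G,s,T)$, and $S$ is called the source side. The largest minimum isolating cut for $s$ and $T$ is the minimum isolating cut whose source side is the largest. A multiterminal cut for terminals $T=\{t_1,\dots,t_k\}$ (pairwise distinct vertices) is a partition of $V$ into $k$ disjoint blocks $V_1,\dots,V_k$ with $t_j\in V_j$ for all $j$; its weight is the sum of the weights of all edges whose two endpoints lie in different blocks. A minimum multiterminal cut is one of minimum weight. -}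

module Defs where

open import Data.Bool.Base using (if_then_else_)
open import Data.Fin.Base using (Fin)
open import Data.Fin.Properties using (_≤?_; _≟_)
open import Data.Fin.Subset using (Subset; _∈_; _∉_; ∣_∣)
open import Data.Fin.Subset.Properties using (_∈?_)
open import Data.Nat.Base as ℕ using (ℕ)
open import Data.Nat.Properties using (+-0-commutativeMonoid)
open import Data.Product.Base using (_×_; ∃-syntax)
open import Data.Sum.Base using (_⊎_)
open import Level using (0ℓ)
open import Relation.Binary.Core using (Rel)
open import Relation.Binary.Definitions using (Symmetric; Decidable)
open import Relation.Binary.PropositionalEquality using (_≡_; _≢_)
open import Relation.Nullary.Decidable using (does; ¬?; _×-dec_; _⊎-dec_)
open import Relation.Unary using (Pred)

open import Algebra.Properties.CommutativeMonoid.Sum +-0-commutativeMonoid using (sum)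

private
  variable
    n k : ℕ

-- An undirected edge is a pair of vertices related by _~_ (in both orders);
-- loops are not excluded.  The values of w at pairs that are not edges are
-- junk and are never used.
record WeightedGraph (n : ℕ) : Set₁ where
  infix 4 _~_ _~?_
  field
    _~_   : Rel (Fin n) 0ℓ
    _~?_  : Decidable _~_
    ~-sym : Symmetric _~_
    w     : Fin n → Fin n → ℕ
    w-sym : ∀ {x y} → x ~ y → w x y ≡ w y x

-- Total weight of the edges {x , y} with R x y, for a symmetric R.  The
-- condition x ≤ y makes every undirected edge count exactly once.
edgeWeight : WeightedGraph n → {R : Rel (Fin n) 0ℓ} → Decidable R → ℕ
edgeWeight G R? = sum λ x → sum λ y →
  if does ((x ≤? y) ×-dec (x ~? y) ×-dec R? x y) then w x y else 0
  where open WeightedGraph G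

Separates : Subset n → Rel (Fin n) 0ℓ
Separates S x y = (x ∈ S × y ∉ S) ⊎ (x ∉ S × y ∈ S)

separates? : (S : Subset n) → Decidable (Separates S)
separates? S x y =
  ((x ∈? S) ×-dec ¬? (y ∈? S)) ⊎-dec (¬? (x ∈? S) ×-dec (y ∈? S))

-- A bipartition (S , V ∖ S) is given by its source side S.
cutWeight : WeightedGraph n → Subset n → ℕ
cutWeight G S = edgeWeight G (separates? S)

IsIsolatingCut : Fin n → Pred (Fin n) 0ℓ → Subset n → Set
IsIsolatingCut s T S = s ∈ S × (∀ x → T x → x ∉ S)

IsMinIsolatingCut : WeightedGraph n → Fin n → Pred (Fin n) 0ℓ → Subset n → Set
IsMinIsolatingCut G s T S =
  IsIsolatingCut s T S ×
  (∀ S′ → IsIsolatingCut s T S′ → cutWeight G S ℕ.≤ cutWeight G S′)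

IsLargestMinIsolatingCut : WeightedGraph n → Fin n → Pred (Fin n) 0ℓ → Subset n → Set
IsLargestMinIsolatingCut G s T S =
  IsMinIsolatingCut G s T S ×
  (∀ S′ → IsMinIsolatingCut G s T S′ → ∣ S′ ∣ ℕ.≤ ∣ S ∣)

-- The set {t₁ , … , tₖ}.
terminalSet : (Fin k → Fin n) → Pred (Fin n) 0ℓ
terminalSet t x = ∃[ j ] t j ≡ x

-- A partition of V into k labelled disjoint blocks is the map b sending each
-- vertex to the label of its block, so V_j = { x | b x ≡ j }.
IsMultiterminalCut : (Fin k → Fin n) → (Fin n → Fin k) → Set
IsMultiterminalCut t b = ∀ j → b (t j) ≡ j

multicutWeight : WeightedGraph n → (Fin n → Fin k) → ℕ
multicutWeight G b =
  edgeWeight G {λ x y → b x ≢ b y} (λ x y → ¬? (b x ≟ b y))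

IsMinMultiterminalCut : WeightedGraph n → (Fin k → Fin n) → (Fin n → Fin k) → Set
IsMinMultiterminalCut G t b =
  IsMultiterminalCut t b ×
  (∀ b′ → IsMultiterminalCut t b′ → multicutWeight G b ℕ.≤ multicutWeight G b′)

{-# OPTIONS --safe #-}

-- Uncrossing.  Take any minimum multiterminal cut b, let i be the block of v,
-- and let A be the part of Vᵥ that lies in block i.  Since A is itself an
-- isolating cut for v, the cut Vᵥ is no heavier than A.  Moving all of Vᵥ into
-- block i gives a multiterminal cut b′, and counting each edge separately
-- yields  w(b′) + w(A) ≤ w(b) + w(Vᵥ), hence w(b′) ≤ w(b).
module Submission where

open import Defs
open import Data.Fin.Base using (Fin)
open import Data.Fin.Subset using (Subset; _∈_)
open import Data.Nat.Base using (ℕ; NonZero)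
open import Data.Product.Base using (_×_; ∃-syntax)
open import Function.Definitions using (Injective)
open import Relation.Binary.PropositionalEquality using (_≡_)
open import Relation.Nullary.Negation using (¬_)

open import Data.Bool.Base using (true; false; if_then_else_)
open import Data.Fin.Base using (fromℕ<; finToFun; funToFin)
open import Data.Fin.Properties using (_≤?_; _≟_; any?; finToFun-funToFin)
open import Data.Fin.Subset using (_∉_; _∩_)
open import Data.Fin.Subset.Properties using (_∈?_; x∈p∩q⁺; x∈p∩q⁻)
open import Data.List.Base using (allFin)
open import Data.List.Membership.Propositional.Properties using (∈-allFin)
open import Data.List.Relation.Unary.All using (lookup)
open import Data.Nat.Base using (_+_; _^_; _≤_; z≤n; >-nonZero⁻¹)
open import Data.Nat.Properties
  using (≤-refl; ≤-reflexive; ≤-trans; ≤-totalOrder; +-identityʳ; +-mono-≤;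
         +-monoʳ-≤; +-cancelʳ-≤; +-0-commutativeMonoid)
open import Data.Product.Base using (_,_; proj₁; proj₂)
open import Data.Sum.Base using (_⊎_; inj₁; inj₂; [_,_]′)
open import Data.Vec.Base using (tabulate)
open import Data.Vec.Functional.Relation.Binary.Pointwise.Properties using (foldr-cong)
open import Data.Vec.Properties using (lookup⇒[]=; []=⇒lookup; lookup∘tabulate)
open import Function.Base using (_∘_)
open import Level using (0ℓ)
open import Relation.Binary.Core using (Rel)
open import Relation.Binary.Definitions using (Decidable)
open import Relation.Binary.PropositionalEquality
  using (_≢_; _≗_; refl; sym; trans; subst₂)
open import Relation.Nullary.Decidable
  using (Dec; yes; no; does; ¬?; _×-dec_; dec-true)
open import Relation.Nullary.Negation using (contradiction)

open import Algebra.Properties.CommutativeMonoid.Sum +-0-commutativeMonoid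
  using (sum; sum-cong-≗; ∑-distrib-+)
open import Data.List.Extrema ≤-totalOrder using (argmin; f[argmin]≤f[xs])

private
  variable
    n k : ℕ

∑-mono-≤ : {f g : Fin n → ℕ} → (∀ x → f x ≤ g x) → sum f ≤ sum g
∑-mono-≤ = foldr-cong {R = _≤_} {S = _≤_} +-mono-≤ z≤n

-- On indicators the hypotheses say max(R, S) ≤ max(P, Q) and min(R, S) ≤ min(P, Q), and a sum of
-- two indicators is their max plus their min. `A?` and `B?` stand for the guards `x ≤? y` and
-- `x ~? y` shared by all summands of `edgeWeight`.
if-submodular : ∀ {A B R S P Q : Set} (A? : Dec A) (B? : Dec B)
  (R? : Dec R) (S? : Dec S) (P? : Dec P) (Q? : Dec Q) (m : ℕ) →
  (R ⊎ S → P ⊎ Q) → (R → S → P × Q) →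
  (if does (A? ×-dec B? ×-dec R?) then m else 0) +
  (if does (A? ×-dec B? ×-dec S?) then m else 0) ≤
  (if does (A? ×-dec B? ×-dec P?) then m else 0) +
  (if does (A? ×-dec B? ×-dec Q?) then m else 0)
if-submodular (no _) _ _ _ _ _ m ∪⇒ ∩⇒ = z≤n
if-submodular (yes _) (no _) _ _ _ _ m ∪⇒ ∩⇒ = z≤n
if-submodular (yes _) (yes _) (no _) (no _) _ _ m ∪⇒ ∩⇒ = z≤n
if-submodular (yes _) (yes _) R? S? (yes _) (yes _) m ∪⇒ ∩⇒ =
  +-mono-≤ (if≤m (does R?)) (if≤m (does S?))
  where
  if≤m : ∀ c → (if c then m else 0) ≤ m
  if≤m true  = ≤-refl
  if≤m false = z≤n
if-submodular (yes _) (yes _) (yes r) (yes s) (no ¬p) _ m ∪⇒ ∩⇒ = contradiction (proj₁ (∩⇒ r s)) ¬p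
if-submodular (yes _) (yes _) (yes r) (yes s) (yes _) (no ¬q) m ∪⇒ ∩⇒ = contradiction (proj₂ (∩⇒ r s)) ¬q
if-submodular (yes _) (yes _) (yes r) (no _) (no ¬p) (no ¬q) m ∪⇒ ∩⇒ with () ← [ ¬p , ¬q ]′ (∪⇒ (inj₁ r))
if-submodular (yes _) (yes _) (no _) (yes s) (no ¬p) (no ¬q) m ∪⇒ ∩⇒ with () ← [ ¬p , ¬q ]′ (∪⇒ (inj₂ s))
if-submodular (yes _) (yes _) (yes _) (no _) (yes _) (no _) m ∪⇒ ∩⇒ = ≤-refl
if-submodular (yes _) (yes _) (yes _) (no _) (no _) (yes _) m ∪⇒ ∩⇒ = ≤-reflexive (+-identityʳ m)
if-submodular (yes _) (yes _) (no _) (yes _) (yes _) (no _) m ∪⇒ ∩⇒ = ≤-reflexive (sym (+-identityʳ m))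
if-submodular (yes _) (yes _) (no _) (yes _) (no _) (yes _) m ∪⇒ ∩⇒ = ≤-refl

module _ (G : WeightedGraph n) where
  open WeightedGraph G

  edgeWeight-submodular : {R S P Q : Rel (Fin n) 0ℓ}
    (R? : Decidable R) (S? : Decidable S) (P? : Decidable P) (Q? : Decidable Q) →
    (∀ x y → R x y ⊎ S x y → P x y ⊎ Q x y) →
    (∀ x y → R x y → S x y → P x y × Q x y) →
    edgeWeight G R? + edgeWeight G S? ≤ edgeWeight G P? + edgeWeight G Q?
  edgeWeight-submodular R? S? P? Q? ∪⇒ ∩⇒ =
    subst₂ _≤_ (∑∑-distrib-+ _ _) (∑∑-distrib-+ _ _)
      (∑-mono-≤ λ x → ∑-mono-≤ λ y →
        if-submodular (x ≤? y) (x ~? y)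
          (R? x y) (S? x y) (P? x y) (Q? x y) (w x y) (∪⇒ x y) (∩⇒ x y))
    where
    ∑∑-distrib-+ : (f g : Fin n → Fin n → ℕ) →
      sum (λ x → sum λ y → f x y + g x y) ≡
      sum (λ x → sum (f x)) + sum (λ x → sum (g x))
    ∑∑-distrib-+ f g = trans
      (sum-cong-≗ λ x → ∑-distrib-+ (f x) (g x))
      (∑-distrib-+ (λ x → sum (f x)) (λ x → sum (g x)))

  edgeWeight-mono-≤ : {R P : Rel (Fin n) 0ℓ} (R? : Decidable R) (P? : Decidable P) →
    (∀ x y → R x y → P x y) → edgeWeight G R? ≤ edgeWeight G P?
  -- Submodularity with R as second and fourth relation gives R + R ≤ P + R, and the common term
  -- cancels.
  edgeWeight-mono-≤ R? P? R⇒P = +-cancelʳ-≤ (edgeWeight G R?) _ _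
    (edgeWeight-submodular R? R? P? R?
      (λ x y → [ inj₂ , inj₂ ]′) (λ x y r _ → R⇒P x y r , r))

  -- Decoded and pinned labellings agree with the originals only pointwise; this carries weight
  -- bounds across such agreement.
  multicutWeight-cong-≤ : {b c : Fin n → Fin k} → b ≗ c →
    multicutWeight G b ≤ multicutWeight G c
  multicutWeight-cong-≤ {b = b} {c} b≗c =
    edgeWeight-mono-≤ (λ x y → ¬? (b x ≟ b y)) (λ x y → ¬? (c x ≟ c y))
      λ x y bx≢by cx≡cy → bx≢by (trans (b≗c x) (trans cx≡cy (sym (b≗c y))))

-- Labellings are coded by the finite type `Fin (k ^ n)`, so an argmin over all codes exists; `b₀`
-- supplies its starting value. `f-cong` passes from the decoded code of `c` back to `c`.
minimizer : (f : (Fin n → Fin k) → ℕ) → (∀ {b c} → b ≗ c → f b ≤ f c) →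
  (Fin n → Fin k) → ∃[ b ] (∀ c → f b ≤ f c)
minimizer {n} {k} f f-cong b₀ = finToFun code , λ c →
  ≤-trans (lookup (f[argmin]≤f[xs] {f = f ∘ finToFun} (funToFin b₀) codes) (∈-allFin (funToFin c)))
          (f-cong (finToFun-funToFin c))
  where
  codes = allFin (k ^ n)
  code = argmin (f ∘ finToFun) (funToFin b₀) codes

module _ (t : Fin k → Fin n) where

  -- Overwrites b on the terminals, so that minimizing over multiterminal cuts
  -- becomes minimizing over all labellings.
  pin : (Fin n → Fin k) → Fin n → Fin k
  pin b x with any? (λ j → t j ≟ x)
  ... | yes (j , _) = j
  ... | no _        = b x

  pin-cong : ∀ {b c} → b ≗ c → pin b ≗ pin c
  pin-cong b≗c x with any? (λ j → t j ≟ x)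
  ... | yes _ = refl
  ... | no _  = b≗c x

  pin-isMultiterminalCut : Injective _≡_ _≡_ t → ∀ b → IsMultiterminalCut t (pin b)
  pin-isMultiterminalCut t-inj b j with any? (λ i → t i ≟ t j)
  -- The search may return an index other than `j`; distinctness of the terminals rules this out.
  ... | yes (_ , ti≡tj) = t-inj ti≡tj
  ... | no ∄i           = contradiction (j , refl) ∄i

  pin-fixes : ∀ {b} → IsMultiterminalCut t b → pin b ≗ b
  pin-fixes b-cut x with any? (λ j → t j ≟ x)
  ... | yes (j , refl) = sym (b-cut j)
  ... | no _           = refl

  minMultiterminalCut : .{{NonZero k}} → Injective _≡_ _≡_ t →
    (G : WeightedGraph n) → ∃[ b ] IsMinMultiterminalCut G t b
  minMultiterminalCut t-inj G =
    let b , b-min = minimizer (multicutWeight G ∘ pin)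
                      -- Any labelling can start the search, since `pin` turns it into a cut; the
                      -- constant one with the first label exists because `k` is nonzero.
                      (multicutWeight-cong-≤ G ∘ pin-cong) (λ _ → fromℕ< (>-nonZero⁻¹ k))
    in pin b , pin-isMultiterminalCut t-inj b , λ c c-cut →
       ≤-trans (b-min c) (multicutWeight-cong-≤ G (pin-fixes c-cut))

module _ (b : Fin n → Fin k) (i : Fin k) where

  block : Subset n
  block = tabulate λ x → does (b x ≟ i)

  ∈-block⁺ : ∀ {x} → b x ≡ i → x ∈ block
  ∈-block⁺ {x} bx≡i = lookup⇒[]= x block
    (trans (lookup∘tabulate _ x) (dec-true (b x ≟ i) bx≡i))

  ∈-block⁻ : ∀ {x} → x ∈ block → b x ≡ i
  -- In the `no` case the abstracted equation becomes `false ≡ true`, so that clause is absent.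
  ∈-block⁻ {x} x∈ with b x ≟ i | trans (sym (lookup∘tabulate _ x)) ([]=⇒lookup x∈)
  ... | yes bx≡i | _ = bx≡i

  module _ (U : Subset n) where

    absorb : Fin n → Fin k
    absorb x = if does (x ∈? U) then i else b x

    absorb-∈ : ∀ {x} → x ∈ U → absorb x ≡ i
    absorb-∈ {x} x∈U with x ∈? U
    ... | yes _  = refl
    ... | no x∉U = contradiction x∈U x∉U

    absorb-∉ : ∀ {x} → x ∉ U → absorb x ≡ b x
    absorb-∉ {x} x∉U with x ∈? U
    ... | yes x∈U = contradiction x∈U x∉U
    ... | no _    = refl

    private
      A : Subset n
      A = U ∩ block

      A⊆U : ∀ {x} → x ∈ A → x ∈ U
      A⊆U = proj₁ ∘ x∈p∩q⁻ U block

      A⊆block : ∀ {x} → x ∈ A → b x ≡ i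
      A⊆block = ∈-block⁻ ∘ proj₂ ∘ x∈p∩q⁻ U block

      -- Inside `U`, membership in `A` means having label `i`.
      splitByA⇒split : ∀ {x y} → x ∈ A → y ∈ U → y ∉ A → b x ≢ b y
      splitByA⇒split x∈A y∈U y∉A bx≡by =
        y∉A (x∈p∩q⁺ (y∈U , ∈-block⁺ (trans (sym bx≡by) (A⊆block x∈A))))

      -- An edge leaving `U` is cut by `U`. Inside `U`, `absorb` is constant, so only `A` can cut,
      -- and then `b` does too. Outside `U`, `absorb` is `b` and `A` is empty.
      ∪⇒ : ∀ x y → absorb x ≢ absorb y ⊎ Separates A x y →
           b x ≢ b y ⊎ Separates U x y
      ∪⇒ x y p with x ∈? U | y ∈? U
      ∪⇒ x y _ | yes x∈U | no y∉U = inj₂ (inj₁ (x∈U , y∉U))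
      ∪⇒ x y _ | no x∉U | yes y∈U = inj₂ (inj₂ (x∉U , y∈U))
      ∪⇒ x y (inj₁ i≢i) | yes _ | yes _ = contradiction refl i≢i
      ∪⇒ x y (inj₂ (inj₁ (x∈A , y∉A))) | yes _ | yes y∈U =
        inj₁ (splitByA⇒split x∈A y∈U y∉A)
      ∪⇒ x y (inj₂ (inj₂ (x∉A , y∈A))) | yes x∈U | yes _ =
        inj₁ (splitByA⇒split y∈A x∈U x∉A ∘ sym)
      ∪⇒ x y (inj₁ bx≢by) | no _ | no _ = inj₁ bx≢by
      ∪⇒ x y (inj₂ (inj₁ (x∈A , _))) | no x∉U | no _ = contradiction (A⊆U x∈A) x∉U
      ∪⇒ x y (inj₂ (inj₂ (_ , y∈A))) | no _ | no y∉U = contradiction (A⊆U y∈A) y∉U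

      -- The endpoint in `A` lies in `U`, so the other one must lie outside, `absorb` being constant
      -- on `U`. Neither endpoint changes its label under `absorb`, so `b` already separates them.
      ∩⇒ : ∀ x y → absorb x ≢ absorb y → Separates A x y →
           b x ≢ b y × Separates U x y
      ∩⇒ x y ax≢ay (inj₁ (x∈A , _)) with x ∈? U | y ∈? U
      ... | no x∉U  | _       = contradiction (A⊆U x∈A) x∉U
      ... | yes _   | yes _   = contradiction refl ax≢ay
      ... | yes x∈U | no y∉U  =
        (λ bx≡by → ax≢ay (trans (sym (A⊆block x∈A)) bx≡by)) , inj₁ (x∈U , y∉U)
      ∩⇒ x y ax≢ay (inj₂ (_ , y∈A)) with x ∈? U | y ∈? U
      ... | _       | no y∉U  = contradiction (A⊆U y∈A) y∉U
      ... | yes _   | yes _   = contradiction refl ax≢ay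
      ... | no x∉U  | yes y∈U =
        (λ bx≡by → ax≢ay (trans bx≡by (A⊆block y∈A))) , inj₂ (x∉U , y∈U)

    absorb-submodular : (G : WeightedGraph n) →
      multicutWeight G absorb + cutWeight G (U ∩ block) ≤
      multicutWeight G b + cutWeight G U
    absorb-submodular G = edgeWeight-submodular G
      (λ x y → ¬? (absorb x ≟ absorb y)) (separates? (U ∩ block))
      (λ x y → ¬? (b x ≟ b y)) (separates? U) ∪⇒ ∩⇒

lemma5 : (n k : ℕ) .{{_ : NonZero k}}
    (G : WeightedGraph n)
    (t : Fin k → Fin n) → Injective _≡_ _≡_ t →
    (v : Fin n) → ¬ terminalSet t v →
    (Vᵥ : Subset n) → IsLargestMinIsolatingCut G v (terminalSet t) Vᵥ →
    ∃[ b ] (IsMinMultiterminalCut G t b × (∀ x → x ∈ Vᵥ → b x ≡ b v))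
lemma5 n k G t t-inj v _ Vᵥ (((v∈Vᵥ , T∩Vᵥ≡∅) , Vᵥ-min) , _)
  with b , b-cut , b-min ← minMultiterminalCut t t-inj G =
  b′ , (b′-cut , λ c c-cut → ≤-trans b′≤b (b-min c c-cut)) ,
  λ x x∈Vᵥ → trans (absorb-∈ b (b v) Vᵥ x∈Vᵥ) (sym (absorb-∈ b (b v) Vᵥ v∈Vᵥ))
  where
  b′ = absorb b (b v) Vᵥ
  A  = Vᵥ ∩ block b (b v)

  b′-cut : IsMultiterminalCut t b′
  -- `Vᵥ` contains no terminal, so absorbing it leaves all terminal labels intact.
  b′-cut j = trans (absorb-∉ b (b v) Vᵥ (T∩Vᵥ≡∅ (t j) (j , refl))) (b-cut j)

  A-isolating : IsIsolatingCut v (terminalSet t) A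
  A-isolating =
    -- `v` survives the intersection because the absorbing block is its own.
    x∈p∩q⁺ (v∈Vᵥ , ∈-block⁺ b (b v) refl) ,
    λ x x∈T → T∩Vᵥ≡∅ x x∈T ∘ proj₁ ∘ x∈p∩q⁻ Vᵥ _

  b′≤b : multicutWeight G b′ ≤ multicutWeight G b
  -- Minimality of `Vᵥ` against `A` bounds the weight of `Vᵥ` by that of `A`, which then cancels.
  b′≤b = +-cancelʳ-≤ (cutWeight G A) _ _
    (≤-trans (absorb-submodular b (b v) Vᵥ G)
             (+-monoʳ-≤ (multicutWeight G b) (Vᵥ-min A A-isolating)))
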